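{- Let $q\in\{2,3,4\}$, let $W$ be an $\mathbb{F}_q$-weighing matrix $\mathrm{W}(n,m;\mathbb{F}_q)$, and let $G$ be a permutation automorphism group of $W$ acting with $t$ orbits on the rows and $t$ orbits on the columns of $W$, all of the same length. Let $B$ be the $t\times b$ point-by-block incidence matrix of an $(r,\lambda)$-design, and let $R$ be the row orbit matrix of $W$ with respect to $G$. If $r+(t-1)\lambda+m\neq 0$ and $r-\lambda+m\neq 0$ in $\mathbb{F}_q$, then $A=[\,R\mid B\,]$ generates a Hermitian LCD code $C$ of length $t+b$ over $\mathbb{F}_q$.
   Context: For $x\in\mathbb{F}_q$ put $x^{\dagger}=0$ if $x=0$ and $x^{\dagger}=x^{ -1}$ otherwise. For a matrix $M=[m_{ij}]$ over $\mathbb{F}_q$, $M^{*}=[m_{ji}^{\dagger}]$; for a vector $v=[v_0,\dots,v_{N-1}]$, $v^{*}=[v_0^{\dagger},\dots,v_{N-1}^{\dagger}]$. An $\mathbb{F}_q$-weighing matrix $\mathrm{W}(n,m;\mathbb{F}_q)$ is an $n\times n$ matrix $W$ over $\mathbb{F}_q$ with exactly $m$ non-zero entries in each row and column such that $WW^{*}=mI_n$ over $\mathbb{F}_q$. A permutation automorphism of an $n\times n$ matrix $M$ is a pair $(P,Q)$ of permutation matrices with $PMQ^{\top}=M$; these form a group $\mathrm{PAut}(M)$ under $(P,Q)(R,S)=(PR,QS)$, and a permutation automorphism group of $M$ is a subgroup $G\le\mathrm{PAut}(M)$; it acts on the rows (via $P$) and on the columns (via $Q$). Let $\mathcal{R}_1,\dots,\mathcal{R}_t$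 and $\mathcal{C}_1,\dots,\mathcal{C}_t$ be the $G$-orbits on rows and columns, and let $M_{ij}$ be the submatrix of $M$ with rows in $\mathcal{R}_i$ and columns in $\mathcal{C}_j$. All rows of $M_{ij}$ have the same sum $\Gamma_{ij}$ (computed in $\mathbb{F}_q$); the row orbit matrix is the $t\times t$ matrix $R=[\Gamma_{ij}]$ over $\mathbb{F}_q$. An $(r,\lambda)$-design is a finite set of points with a collection of $b$ subsets (blocks) such that each point lies in exactly $r$ blocks and every pair of distinct points lies together in exactly $\lambda$ blocks; its point-by-block incidence matrix is the $(0,1)$-matrix with rows indexed by points, columns by blocks, and entry $1$ exactly when the point lies in the block. Integers are interpreted in $\mathbb{F}_q$. A matrix over $\mathbb{F}_q$ generates the linear code spanned by its rows. The Hermitian dual $C^{H}$ of a linear code $C\subseteq\mathbb{F}_q^N$ is its orthogonal complement under $\langle u,v\rangle_I=u\cdot v^{*}$ (for $q=4$ this is the usual Hermitian dual; for $q\in\{2,3\}$ it is the Euclidean dual), and $C$ is Hermitian LCD if $C\cap C^{H}=\{0\}$. -}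

module Defs where

open import Algebra.Bundles using (CommutativeRing)
open import Algebra.Structures using (IsCommutativeRing)
import Algebra.Properties.Semiring.Sum as SemiringSum
import Algebra.Definitions.RawMonoid as RawMonoidDefs
open import Data.Bool.Base using (if_then_else_)
open import Data.Fin.Base using (Fin; zero; suc)
import Data.Fin.Properties as Fin
open import Data.Fin.Permutation as Perm
  using (Permutation′; _⟨$⟩ʳ_; _∘ₚ_)
open import Data.Fin.Subset using (Subset)
open import Data.Fin.Subset.Properties using (_∈?_)
open import Data.Nat.Base as ℕ using (ℕ)
open import Data.Product.Base using (∃; ∃-syntax; _×_; _,_; proj₁; proj₂)
open import Data.Vec.Base using (count; allFin)
open import Data.Vec.Functional using (Vector; _++_)
open import Function.Base using (_∘_)
open import Function.Bundles using (_↔_; _⇔_; Equivalence)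
open import Function.Definitions using (StrictlySurjective)
open import Function.Properties.Inverse using (↔⇒↣)
open import Level using (Level; 0ℓ) renaming (suc to lsuc)
open import Relation.Binary.Definitions using (DecidableEquality)
open import Relation.Binary.PropositionalEquality
  using (_≡_; _≢_; refl; sym; trans; cong; cong₂)
open import Relation.Nullary using (does; ¬?)
open import Relation.Nullary.Decidable using (via-injection; _×-dec_; dec-true; dec-false)
open import Relation.Unary using (Pred; Decidable; _∩_; _≐_)

infix 9 #_
#_ : ∀ {p n} {P : Pred (Fin n) p} → Decidable P → ℕ
# P? = count P? (allFin _)

-- A field with q elements; the value 0# ⁻¹ is unconstrained.
record FiniteField (q : ℕ) : Set₁ where
  infix  8 _⁻¹ -_
  infixl 7 _*_
  infixl 6 _+_ _-_
  field
    Carrier           : Set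
    _+_ _*_           : Carrier → Carrier → Carrier
    -_ _⁻¹            : Carrier → Carrier
    0# 1#             : Carrier
    isCommutativeRing : IsCommutativeRing _≡_ _+_ _*_ -_ 0# 1#
    0≢1               : 0# ≢ 1#
    *-inverseʳ        : ∀ x → x ≢ 0# → x * x ⁻¹ ≡ 1#
    enumeration       : Carrier ↔ Fin q

  commutativeRing : CommutativeRing 0ℓ 0ℓ
  commutativeRing = record { isCommutativeRing = isCommutativeRing }

  _-_ : Carrier → Carrier → Carrier
  x - y = x + - y

  _≟_ : DecidableEquality Carrier
  _≟_ = via-injection (↔⇒↣ enumeration) Fin._≟_

record IsRLambdaDesign {t b : ℕ} (block : Fin b → Subset t) (r lam : ℕ) : Set where
  field
    point-degree : ∀ x → # (λ k → x ∈? block k) ≡ r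
    pair-degree  : ∀ x y → x ≢ y →
                   # (λ k → (x ∈? block k) ×-dec (y ∈? block k)) ≡ lam

module OverField {q : ℕ} (F : FiniteField q) where
  open FiniteField F
  open SemiringSum (CommutativeRing.semiring commutativeRing)
    using (sum; sum-cong-≗; sum-permute; sum-replicate-zero)
  open RawMonoidDefs (CommutativeRing.+-rawMonoid commutativeRing)
    using () renaming (_×_ to _·_)

  ⟦_⟧ : ℕ → Carrier
  ⟦ k ⟧ = k · 1#

  infix 10 _†
  _† : Carrier → Carrier
  x † = if does (x ≟ 0#) then 0# else x ⁻¹

  Matrix : ℕ → ℕ → Set
  Matrix k l = Fin k → Fin l → Carrier

  infix  4 _≋_
  infixl 7 _⊗_
  infix 10 _ᵀ _⋆

  _≋_ : ∀ {k l} → Matrix k l → Matrix k l → Set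
  M ≋ N = ∀ i j → M i j ≡ N i j

  _⊗_ : ∀ {k l o} → Matrix k l → Matrix l o → Matrix k o
  (M ⊗ N) i j = sum λ x → M i x * N x j

  _ᵀ : ∀ {k l} → Matrix k l → Matrix l k
  (M ᵀ) i j = M j i

  _⋆ : ∀ {k l} → Matrix k l → Matrix l k
  (M ⋆) i j = (M j i) †

  scalar : ∀ {k} → Carrier → Matrix k k
  scalar a i j = if does (i Fin.≟ j) then a else 0#

  infixr 5 _∣_
  _∣_ : ∀ {k l o} → Matrix k l → Matrix k o → Matrix k (l ℕ.+ o)
  (M ∣ N) i = M i ++ N i

  record IsWeighing {n : ℕ} (m : ℕ) (W : Matrix n n) : Set where
    field
      row-weight : ∀ i → # (λ j → ¬? (W i j ≟ 0#)) ≡ m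
      col-weight : ∀ j → # (λ i → ¬? (W i j ≟ 0#)) ≡ m
      WW⋆≋mI     : W ⊗ W ⋆ ≋ scalar ⟦ m ⟧

  -- With the 1 of row i placed in column σ i, permMatrix turns σ ∘ₚ τ into
  -- the product permMatrix σ ⊗ permMatrix τ.
  permMatrix : ∀ {n} → Permutation′ n → Matrix n n
  permMatrix σ i j = if does ((σ ⟨$⟩ʳ i) Fin.≟ j) then 1# else 0#

  -- A pair (P, Q) of permutation matrices is represented by the underlying
  -- pair of permutations.
  PAut : ∀ {n} → Matrix n n → Pred (Permutation′ n × Permutation′ n) 0ℓ
  PAut M (σ , τ) = permMatrix σ ⊗ M ⊗ (permMatrix τ) ᵀ ≋ M

  -- A subgroup of PAut M; `respects` is needed because permutations are
  -- compared pointwise rather than by _≡_.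
  record PAutGroup {n : ℕ} (M : Matrix n n) (g : Level) : Set (lsuc g) where
    field
      Member   : Pred (Permutation′ n × Permutation′ n) g
      respects : ∀ {σ σ′ τ τ′} → σ Perm.≈ σ′ → τ Perm.≈ τ′ →
                 Member (σ , τ) → Member (σ′ , τ′)
      ⊆PAut    : ∀ {h} → Member h → PAut M h
      id-mem   : Member (Perm.id , Perm.id)
      ∘-mem    : ∀ {σ σ′ τ τ′} → Member (σ , τ) → Member (σ′ , τ′) →
                 Member (σ ∘ₚ σ′ , τ ∘ₚ τ′)
      inv-mem  : ∀ {σ τ} → Member (σ , τ) → Member (Perm.flip σ , Perm.flip τ)

    SameRowOrbit : Fin n → Fin n → Set g
    SameRowOrbit x y = ∃[ h ] Member h × (proj₁ h ⟨$⟩ʳ x) ≡ y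

    SameColOrbit : Fin n → Fin n → Set g
    SameColOrbit x y = ∃[ h ] Member h × (proj₂ h ⟨$⟩ʳ x) ≡ y

  -- An enumeration by Fin t of the classes of _~_, all of which have size ℓ:
  -- the class numbered a is { x | index x ≡ a }.
  record Orbits {n : ℕ} {g : Level} (_~_ : Fin n → Fin n → Set g) (t ℓ : ℕ) : Set g where
    field
      index      : Fin n → Fin t
      nonempty   : StrictlySurjective _≡_ index
      index-orb  : ∀ x y → index x ≡ index y ⇔ x ~ y
      orb-length : ∀ a → # (λ x → index x Fin.≟ a) ≡ ℓ

    representative : Fin t → Fin n
    representative a = proj₁ (nonempty a)

  module _ {n t ℓ : ℕ} {g : Level} {W : Matrix n n} (G : PAutGroup W g)
           (rowOrbits : Orbits (PAutGroup.SameRowOrbit G) t ℓ)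
           (colOrbits : Orbits (PAutGroup.SameColOrbit G) t ℓ) where
    open PAutGroup G
    private
      module 𝓡 = Orbits rowOrbits
      module 𝓒 = Orbits colOrbits

    blockRowSum : Fin n → Fin t → Carrier
    blockRowSum x j = sum λ c → if does (𝓒.index c Fin.≟ j) then W x c else 0#

    -- By blockRowSum≡rowOrbitMatrix below, the choice of representative row
    -- is immaterial.
    rowOrbitMatrix : Matrix t t
    rowOrbitMatrix i j = blockRowSum (𝓡.representative i) j

  incidence : ∀ {t b} → (Fin b → Subset t) → Matrix t b
  incidence block x k = if does (x ∈? block k) then 1# else 0#

  Code : ℕ → Set₁
  Code N = Pred (Vector Carrier N) 0ℓ

  generatedBy : ∀ {k N} → Matrix k N → Code N
  generatedBy {k} A v = ∃ λ (c : Vector Carrier k) → ∀ j → v j ≡ sum λ i → c i * A i j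

  ⟨_,_⟩ : ∀ {N} → Vector Carrier N → Vector Carrier N → Carrier
  ⟨ u , v ⟩ = sum λ i → u i * (v i) †

  infix 10 _ᴴ
  _ᴴ : ∀ {N} → Code N → Code N
  (C ᴴ) v = ∀ u → C u → ⟨ v , u ⟩ ≡ 0#

  ZeroCode : ∀ {N} → Code N
  ZeroCode v = ∀ j → v j ≡ 0#

  IsHermitianLCD : ∀ {N} → Code N → Set
  IsHermitianLCD C = C ∩ C ᴴ ≐ ZeroCode

  private
    module R = CommutativeRing commutativeRing

    sum-δ : ∀ {n} (a : Fin n) (f g : Vector Carrier n) →
            g a ≡ f a → (∀ x → a ≢ x → g x ≡ 0#) → sum g ≡ f a
    sum-δ {ℕ.suc n} zero f g e z = trans
      (cong₂ _+_ e (trans (sum-cong-≗ λ x → z (suc x) λ ()) (sum-replicate-zero n)))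
      (R.+-identityʳ _)
    sum-δ (suc a) f g e z = trans
      (cong₂ _+_ (z zero λ ())
        (sum-δ a (f ∘ suc) (g ∘ suc) e λ x a≢x → z (suc x) (a≢x ∘ Fin.suc-injective)))
      (R.+-identityˡ _)

    permMatrix-1 : ∀ {n} (σ : Permutation′ n) i → permMatrix σ i (σ ⟨$⟩ʳ i) ≡ 1#
    permMatrix-1 σ i = cong (if_then 1# else 0#)
      (dec-true ((σ ⟨$⟩ʳ i) Fin.≟ (σ ⟨$⟩ʳ i)) refl)

    permMatrix-0 : ∀ {n} (σ : Permutation′ n) i j → (σ ⟨$⟩ʳ i) ≢ j → permMatrix σ i j ≡ 0#
    permMatrix-0 σ i j ≢ = cong (if_then 1# else 0#) (dec-false ((σ ⟨$⟩ʳ i) Fin.≟ j) ≢)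

  PAut-entry : ∀ {n} {M : Matrix n n} {σ τ} → PAut M (σ , τ) →
               ∀ i j → M (σ ⟨$⟩ʳ i) (τ ⟨$⟩ʳ j) ≡ M i j
  PAut-entry {M = M} {σ} {τ} aut i j = trans (sym lhs) (aut i j)
    where
    left : ∀ y → (permMatrix σ ⊗ M) i y ≡ M (σ ⟨$⟩ʳ i) y
    left y = sum-δ (σ ⟨$⟩ʳ i) (λ x → M x y) _
      (trans (cong (_* _) (permMatrix-1 σ i)) (R.*-identityˡ _))
      (λ x ne → trans (cong (_* _) (permMatrix-0 σ i x ne)) (R.zeroˡ _))

    lhs : (permMatrix σ ⊗ M ⊗ (permMatrix τ) ᵀ) i j ≡ M (σ ⟨$⟩ʳ i) (τ ⟨$⟩ʳ j)
    lhs = trans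
      (sum-δ (τ ⟨$⟩ʳ j) (λ y → (permMatrix σ ⊗ M) i y) _
        (trans (cong ((permMatrix σ ⊗ M) i (τ ⟨$⟩ʳ j) *_) (permMatrix-1 τ j)) (R.*-identityʳ _))
        (λ x ne → trans (cong ((permMatrix σ ⊗ M) i x *_) (permMatrix-0 τ j x ne)) (R.zeroʳ _)))
      (left _)

  blockRowSum≡rowOrbitMatrix :
    ∀ {n t ℓ g} {W : Matrix n n} (G : PAutGroup W g)
    (rowOrbits : Orbits (PAutGroup.SameRowOrbit G) t ℓ)
    (colOrbits : Orbits (PAutGroup.SameColOrbit G) t ℓ) x j →
    blockRowSum G rowOrbits colOrbits x j ≡
    rowOrbitMatrix G rowOrbits colOrbits (Orbits.index rowOrbits x) j
  blockRowSum≡rowOrbitMatrix {W = W} G rowOrbits colOrbits x j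
    with Equivalence.to (Orbits.index-orb rowOrbits x (Orbits.representative rowOrbits (Orbits.index rowOrbits x)))
           (sym (proj₂ (Orbits.nonempty rowOrbits (Orbits.index rowOrbits x))))
  ... | (σ , τ) , h , σx≡y = sym (trans
    (sum-permute (λ c → if does (Orbits.index colOrbits c Fin.≟ j) then W (Orbits.representative rowOrbits (Orbits.index rowOrbits x)) c
      else 0#) τ)
    (sum-cong-≗ λ c → cong₂ (λ a w → if does (a Fin.≟ j) then w else 0#)
      (sym (Equivalence.from (Orbits.index-orb colOrbits c (τ ⟨$⟩ʳ c)) ((σ , τ) , h , refl)))
      (trans (cong (λ y → W y (τ ⟨$⟩ʳ c)) (sym σx≡y))
             (PAut-entry {σ = σ} {τ} (PAutGroup.⊆PAut G h) x c))))

{-# OPTIONS --safe #-}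

-- For q ≤ 4 the map x ↦ x† is additive: Fermat's x^q = x makes it the identity
-- or, for q = 4, squaring.  As G has equally long orbits on rows and columns,
-- every row of a block of W takes each value as often as every column does, so
-- the row orbit matrix R also consists of column sums and R R* = m I.
-- Together with B B* = (r - λ) I + λ J this gives
-- A A* = (r - λ + m) I + λ J.  A codeword c A orthogonal to all rows of A
-- satisfies (Σ c) λ + c_k (r - λ + m) = 0 for all k; summing over k shows
-- Σ c = 0, and then c = 0.
module Submission where

open import Defs
open import Algebra.Bundles using (CommutativeMonoid; CommutativeRing)
import Algebra.Properties.CommutativeMonoid.Sum as MonoidSum
import Algebra.Properties.Monoid.Mult as MonoidMult
import Algebra.Properties.Ring as RingProperties
import Algebra.Properties.Semiring.Exp as SemiringExp
import Algebra.Properties.Semiring.Mult as SemiringMult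
import Algebra.Properties.Semiring.Sum as SemiringSum
import Algebra.Solver.Ring.NaturalCoefficients.Default as SemiringSolver
open import Data.Bool.Base using (Bool; true; false; _∧_; if_then_else_)
open import Data.Bool.Properties using (if-float; if-cong; if-cong-then; if-cong-else)
open import Data.Fin.Base using (Fin; zero; suc; _↑ˡ_; _↑ʳ_)
import Data.Fin.Properties as Fin
open import Data.Fin.Permutation using (_⟨$⟩ʳ_)
open import Data.Fin.Subset using (Subset)
open import Data.Fin.Subset.Properties using (_∈?_)
open import Data.List.Base using ([]; _∷_)
open import Data.List.Membership.Propositional using (_∈_)
open import Data.List.Relation.Unary.Any using (here; there)
open import Data.Nat.Base as ℕ using (ℕ; zero; suc; _≤_)
import Data.Nat.Properties as ℕ
open import Data.Product.Base using (_×_; _,_; proj₂)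
open import Data.Vec.Base using (count; tabulate)
open import Data.Vec.Functional.Properties using (lookup-++ˡ; lookup-++ʳ)
open import Function.Base using (_∘_; id)
open import Function.Bundles using (_↔_; Inverse; Equivalence; mk⇔; mk↔ₛ′)
open import Function.Properties.Inverse using (↔-sym; ↔-trans)
open import Level using (Level)
open import Relation.Binary.PropositionalEquality
  using (_≡_; _≢_; refl; sym; trans; cong; cong₂; subst; module ≡-Reasoning)
open import Relation.Nullary using (Dec; does; yes; no; contradiction)
open import Relation.Nullary.Decidable using (dec-true; dec-false; does-⇔; _×-dec_)
open import Relation.Unary using (Pred; Decidable)

-- Sums over indicators and counting.

if-swap : ∀ {a} {A : Set a} b c {x y : A} →
          (if b then (if c then x else y) else y) ≡ (if c then (if b then x else y) else y)
if-swap true  c     = refl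
if-swap false true  = refl
if-swap false false = refl

-- Over an arbitrary commutative monoid, because the same facts serve for sums in `ℕ`, sums in the
-- field and, with the multiplicative monoid, products in the field.
module IndicatorSums {c ℓ} (M : CommutativeMonoid c ℓ) where
  open CommutativeMonoid M
    renaming (_∙_ to _+_; ε to 0#; identityˡ to +-identityˡ; identityʳ to +-identityʳ;
              ∙-cong to +-cong; ∙-congˡ to +-congˡ; assoc to +-assoc; sym to ≈-sym;
              refl to ≈-refl; trans to ≈-trans)
  open MonoidSum M
  open MonoidMult monoid renaming (_×_ to _·_)

  sum-zero : ∀ {n} {f : Fin n → Carrier} → (∀ i → f i ≈ 0#) → sum f ≈ 0#
  sum-zero {n} f≈0 = ≈-trans (sum-cong-≋ f≈0) (sum-replicate-zero n)

  sum-supported : ∀ {n} (a : Fin n) (f : Fin n → Carrier) →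
                  (∀ i → a ≢ i → f i ≈ 0#) → sum f ≈ f a
  sum-supported zero    f f≈0 =
    ≈-trans (+-congˡ (sum-zero λ i → f≈0 (suc i) λ ())) (+-identityʳ _)
  sum-supported (suc a) f f≈0 = ≈-trans
    (+-cong (f≈0 zero λ ())
            (sum-supported a (f ∘ suc) λ i a≢i → f≈0 (suc i) (a≢i ∘ Fin.suc-injective)))
    (+-identityˡ _)

  sum-δ : ∀ {n} (a : Fin n) (f : Fin n → Carrier) →
          sum (λ i → if does (a Fin.≟ i) then f i else 0#) ≈ f a
  sum-δ a f = ≈-trans
    (sum-supported a _ λ i a≢i → reflexive (if-cong (dec-false (a Fin.≟ i) a≢i)))
    (reflexive (if-cong (dec-true (a Fin.≟ a) refl)))

  if-sum : ∀ {n} b (f : Fin n → Carrier) →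
           (if b then sum f else 0#) ≈ sum (λ i → if b then f i else 0#)
  if-sum     true  f = ≈-refl
  if-sum {n} false f = ≈-sym (sum-replicate-zero n)

  -- `allFin` is `tabulate id`, and its tail is tabulated by `suc`; the general `f` makes the
  -- induction go through.
  count-· : ∀ {p k n} {P : Pred (Fin k) p} (P? : Decidable P) (f : Fin n → Fin k) a →
            count P? (tabulate f) · a ≈ sum (λ i → if does (P? (f i)) then a else 0#)
  count-· {n = zero}  P? f a = ≈-refl
  count-· {n = suc n} P? f a with does (P? (f zero))
  ... | true  = +-congˡ (count-· P? (f ∘ suc) a)
  ... | false = ≈-trans (count-· P? (f ∘ suc) a) (≈-sym (+-identityˡ _))

  #-· : ∀ {p n} {P : Pred (Fin n) p} (P? : Decidable P) a →
        (# P?) · a ≈ sum (λ i → if does (P? i) then a else 0#)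
  #-· P? = count-· P? id

  sum-↑ : ∀ m {n} (f : Fin (m ℕ.+ n) → Carrier) →
          sum f ≈ sum (λ i → f (i ↑ˡ n)) + sum (λ i → f (m ↑ʳ i))
  sum-↑ zero    f = ≈-sym (+-identityˡ _)
  sum-↑ (suc m) f = ≈-trans (+-congˡ (sum-↑ m (f ∘ suc))) (≈-sym (+-assoc _ _ _))

module ℕΣ where
  open MonoidSum ℕ.+-0-commutativeMonoid public
  open IndicatorSums ℕ.+-0-commutativeMonoid public
  open MonoidMult ℕ.+-0-monoid public renaming (_×_ to _·_)

  ·≡* : ∀ m n → m · n ≡ m ℕ.* n
  ·≡* zero    n = refl
  ·≡* (suc m) n = cong (n ℕ.+_) (·≡* m n)

  ≤-sum : ∀ {n} (f : Fin n → ℕ) i → f i ≤ sum f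
  ≤-sum f zero    = ℕ.m≤m+n _ _
  ≤-sum f (suc i) = ℕ.≤-trans (≤-sum (f ∘ suc) i) (ℕ.m≤n+m _ _)

  #-≥1 : ∀ {p n} {P : Pred (Fin n) p} (P? : Decidable P) {i} → P i → 1 ≤ # P?
  #-≥1 P? {i} p = begin
    1                                             ≡⟨ if-cong (dec-true (P? i) p) ⟨
    (if does (P? i) then 1 else 0)                ≤⟨ ≤-sum (λ k → if does (P? k) then 1 else 0) i ⟩
    sum (λ k → if does (P? k) then 1 else 0)      ≡⟨ #-· P? 1 ⟨
    (# P?) · 1                                    ≡⟨ ·≡* (# P?) 1 ⟩
    (# P?) ℕ.* 1                                  ≡⟨ ℕ.*-identityʳ _ ⟩
    # P?                                          ∎
    where open ℕ.≤-Reasoning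

-- Finite fields: characteristic and Fermat's theorem.

module FieldProperties {q : ℕ} (F : FiniteField q) where
  open FiniteField F
  open OverField F
  open CommutativeRing commutativeRing
    using (semiring; ring; +-commutativeMonoid; *-commutativeMonoid; +-assoc;
           +-identityʳ; *-assoc; *-comm; *-identityˡ; *-identityʳ; zeroˡ; zeroʳ;
           commutativeSemiring)
  open RingProperties ring using (+-cancelˡ)
  open SemiringExp semiring using (_^_)
  open SemiringSolver commutativeSemiring using (solve; _:+_; _:*_; _:=_; con)
  open ≡-Reasoning
  private
    module Sum = MonoidSum +-commutativeMonoid
    module Prod where
      open MonoidSum *-commutativeMonoid public
        renaming (sum to product; sum-cong-≗ to product-cong-≗)
      open IndicatorSums *-commutativeMonoid public

    elem : Fin q → Carrier
    elem = Inverse.from enumeration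

  *-cancelˡ-≢0 : ∀ {a} → a ≢ 0# → ∀ {x y} → a * x ≡ a * y → x ≡ y
  *-cancelˡ-≢0 {a} a≢0 {x} {y} ax≡ay = begin
    x                ≡⟨ unfold x ⟩
    a ⁻¹ * (a * x)   ≡⟨ cong (a ⁻¹ *_) ax≡ay ⟩
    a ⁻¹ * (a * y)   ≡⟨ unfold y ⟨
    y                ∎
    where
    unfold : ∀ z → z ≡ a ⁻¹ * (a * z)
    unfold z = begin
      z                ≡⟨ *-identityˡ z ⟨
      1# * z           ≡⟨ cong (_* z) (trans (*-comm _ _) (*-inverseʳ a a≢0)) ⟨
      a ⁻¹ * a * z     ≡⟨ *-assoc _ _ _ ⟩
      a ⁻¹ * (a * z)   ∎

  *-≢0 : ∀ {a b} → a ≢ 0# → b ≢ 0# → a * b ≢ 0#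
  *-≢0 {a} a≢0 b≢0 ab≡0 = b≢0 (*-cancelˡ-≢0 a≢0 (trans ab≡0 (sym (zeroʳ a))))

  *≡0⇒≡0 : ∀ {a b} → a ≢ 0# → b * a ≡ 0# → b ≡ 0#
  *≡0⇒≡0 {a} a≢0 ba≡0 =
    *-cancelˡ-≢0 a≢0 (trans (*-comm _ _) (trans ba≡0 (sym (zeroʳ a))))

  module _ {c ℓ} (M : CommutativeMonoid c ℓ) where
    open CommutativeMonoid M using (_≈_) renaming (Carrier to A; trans to ≈-trans; reflexive to ≈-reflexive)
    open MonoidSum M

    -- Conjugating `φ` by the enumeration gives a permutation of `Fin q`, which a sum does not
    -- notice. It is used additively for translations and multiplicatively for scalings.
    sum-reindex : (f : Carrier → A) (φ : Carrier ↔ Carrier) →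
                  sum (f ∘ elem) ≈ sum (f ∘ Inverse.to φ ∘ elem)
    sum-reindex f φ = ≈-trans
      (sum-permute (f ∘ elem) (↔-trans (↔-sym enumeration) (↔-trans φ enumeration)))
      (≈-reflexive (sum-cong-≗ {q} λ i →
        cong f (Inverse.strictlyInverseʳ enumeration (Inverse.to φ (elem i)))))

  -- Translation by 1 permutes the field, so adding up all elements gives q · 1 = 0.
  ⟦q⟧≡0 : ⟦ q ⟧ ≡ 0#
  ⟦q⟧≡0 = +-cancelˡ (Sum.sum elem) _ _ (begin
    Sum.sum elem + ⟦ q ⟧                      ≡⟨ cong (Sum.sum elem +_) (Sum.sum-replicate q) ⟨
    Sum.sum elem + Sum.sum {q} (λ _ → 1#)     ≡⟨ Sum.∑-distrib-+ {q} elem (λ _ → 1#) ⟨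
    Sum.sum (λ i → elem i + 1#)               ≡⟨ sum-reindex +-commutativeMonoid id +1 ⟨
    Sum.sum elem                              ≡⟨ +-identityʳ _ ⟨
    Sum.sum elem + 0#                         ∎)
    where
    cancel : ∀ x {y z} → y + z ≡ 0# → x + y + z ≡ x
    cancel x e = trans (+-assoc _ _ _) (trans (cong (x +_) e) (+-identityʳ x))

    +1 : Carrier ↔ Carrier
    +1 = mk↔ₛ′ (_+ 1#) (_- 1#)
      (λ x → cancel x (CommutativeRing.-‿inverseˡ commutativeRing 1#))
      (λ x → cancel x (CommutativeRing.-‿inverseʳ commutativeRing 1#))

  -- Multiplication by x ≠ 0 permutes the field; compare the products of all
  -- elements, with 0 replaced by 1.
  x^q≡x-≢0 : ∀ {x} → x ≢ 0# → x ^ q ≡ x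
  x^q≡x-≢0 {x} x≢0 = begin
    x ^ q                                           ≡⟨ Prod.sum-replicate q ⟨
    product {q} (λ _ → x)                           ≡⟨ product-cong-≗ (scale*fix ∘ elem) ⟨
    product (λ i → scale (elem i) * fix (elem i))   ≡⟨ Prod.∑-distrib-+ (scale ∘ elem) (fix ∘ elem) ⟩
    product (scale ∘ elem) * product (fix ∘ elem)   ≡⟨ cong₂ _*_ ∏scale≡1 ∏fix≡x ⟩
    1# * x                                          ≡⟨ *-identityˡ x ⟩
    x                                               ∎
    where
    open Prod using (product; product-cong-≗)

    -- `scale` is the factor by which `unit` changes when its argument is multiplied by `x`. `fix`
    -- supplies the factor `x` that `scale` lacks at 0, so the exponent becomes `q` instead of
    -- `q - 1`.
    unit scale fix : Carrier → Carrier
    unit  y = if does (y ≟ 0#) then 1# else y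
    scale y = if does (y ≟ 0#) then 1# else x
    fix   y = if does (y ≟ 0#) then x else 1#

    unit-* : ∀ y → unit (x * y) ≡ unit y * scale y
    unit-* y = by-cases (y ≟ 0#)
      where
      by-cases : (d : Dec (y ≡ 0#)) →
        unit (x * y) ≡ (if does d then 1# else y) * (if does d then 1# else x)
      by-cases (yes y≡0) = trans
        (if-cong (dec-true ((x * y) ≟ 0#) (trans (cong (x *_) y≡0) (zeroʳ x))))
        (sym (*-identityˡ 1#))
      by-cases (no y≢0) = trans
        (if-cong (dec-false ((x * y) ≟ 0#) (*-≢0 x≢0 y≢0)))
        (*-comm x y)

    scale*fix : ∀ y → scale y * fix y ≡ x
    scale*fix y with does (y ≟ 0#)
    ... | true  = *-identityˡ x
    ... | false = *-identityʳ x

    unit-≢0 : ∀ y → unit y ≢ 0#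
    unit-≢0 y = by-cases (y ≟ 0#)
      where
      by-cases : (d : Dec (y ≡ 0#)) → (if does d then 1# else y) ≢ 0#
      by-cases (yes _)   = 0≢1 ∘ sym
      by-cases (no  y≢0) = y≢0

    product-≢0 : ∀ {n} (f : Fin n → Carrier) → (∀ i → f i ≢ 0#) → product f ≢ 0#
    product-≢0 {zero}  f f≢0 = 0≢1 ∘ sym
    product-≢0 {suc n} f f≢0 = *-≢0 (f≢0 zero) (product-≢0 (f ∘ suc) (f≢0 ∘ suc))

    x* : Carrier ↔ Carrier
    x* = mk↔ₛ′ (x *_) (x ⁻¹ *_) inverse (λ y → *-cancelˡ-≢0 x≢0 (inverse (x * y)))
      where
      inverse : ∀ y → x * (x ⁻¹ * y) ≡ y
      inverse y = trans (sym (*-assoc _ _ _))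
        (trans (cong (_* y) (*-inverseʳ x x≢0)) (*-identityˡ y))

    ∏scale≡1 : product (scale ∘ elem) ≡ 1#
    -- The product of all `unit y` is non-zero and does not change when `y` is replaced by `x * y`,
    -- so it can be cancelled.
    ∏scale≡1 = *-cancelˡ-≢0 (product-≢0 (unit ∘ elem) (unit-≢0 ∘ elem)) (begin
      product (unit ∘ elem) * product (scale ∘ elem)    ≡⟨ Prod.∑-distrib-+ (unit ∘ elem) (scale ∘ elem) ⟨
      product (λ i → unit (elem i) * scale (elem i))    ≡⟨ product-cong-≗ (unit-* ∘ elem) ⟨
      product (λ i → unit (x * elem i))                 ≡⟨ sum-reindex *-commutativeMonoid unit x* ⟨
      product (unit ∘ elem)                             ≡⟨ *-identityʳ _ ⟨
      product (unit ∘ elem) * 1#                        ∎)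

    ∏fix≡x : product (fix ∘ elem) ≡ x
    ∏fix≡x = trans
      -- Only the index of 0 contributes a factor that may differ from 1.
      (Prod.sum-supported (Inverse.to enumeration 0#) (fix ∘ elem) λ i 0≢i →
        if-cong (dec-false (elem i ≟ 0#) λ e →
          0≢i (trans (cong (Inverse.to enumeration) (sym e)) (Inverse.strictlyInverseˡ enumeration i))))
      (if-cong (dec-true (elem (Inverse.to enumeration 0#) ≟ 0#) (Inverse.strictlyInverseʳ enumeration 0#)))

  -- The map `x †` in fields with 2, 3 or 4 elements.

  0†≡0 : 0# † ≡ 0#
  0†≡0 = if-cong (dec-true (0# ≟ 0#) refl)

  †-inverseʳ : ∀ {x} → x ≢ 0# → x * x † ≡ 1#
  †-inverseʳ {x} x≢0 = trans (cong (x *_) (if-cong (dec-false (x ≟ 0#) x≢0))) (*-inverseʳ x x≢0)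

  -- For `x` non-zero, cancelling `x` once gives `x * y ≡ 1#`, which is also `x * x †`; cancelling
  -- again gives the claim. This reads `x †` off from Fermat's equation.
  x*[x*y]≡x⇒x†≡y : ∀ {x y} → (x ≡ 0# → y ≡ 0#) → (x ≢ 0# → x * (x * y) ≡ x) → x † ≡ y
  x*[x*y]≡x⇒x†≡y {x} {y} y≡0 xxy≡x with x ≟ 0#
  ... | yes x≡0 = trans (cong _† x≡0) (trans 0†≡0 (sym (y≡0 x≡0)))
  ... | no  x≢0 = *-cancelˡ-≢0 x≢0 (trans (†-inverseʳ x≢0)
    (sym (*-cancelˡ-≢0 x≢0 (trans (xxy≡x x≢0) (sym (*-identityʳ x))))))

  x²≡x⇒x†≡x : ∀ {x} → (x ≢ 0# → x ^ 2 ≡ x) → x † ≡ x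
  x²≡x⇒x†≡x {x} e = x*[x*y]≡x⇒x†≡y id λ x≢0 →
    let x*x≡x = trans (cong (x *_) (sym (*-identityʳ x))) (e x≢0) in
    trans (cong (x *_) x*x≡x) x*x≡x

  x³≡x⇒x†≡x : ∀ {x} → (x ≢ 0# → x ^ 3 ≡ x) → x † ≡ x
  x³≡x⇒x†≡x {x} e = x*[x*y]≡x⇒x†≡y id λ x≢0 →
    -- `x ^ 3` unfolds to `x * (x * (x * 1#))`, so a trailing `1#` has to be inserted.
    trans (cong (λ y → x * (x * y)) (sym (*-identityʳ x))) (e x≢0)

  x⁴≡x⇒x†≡x*x : ∀ {x} → (x ≢ 0# → x ^ 4 ≡ x) → x † ≡ x * x
  x⁴≡x⇒x†≡x*x {x} e = x*[x*y]≡x⇒x†≡y (λ x≡0 → trans (cong (_* x) x≡0) (zeroˡ x)) λ x≢0 →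
    trans (cong (λ y → x * (x * (x * y))) (sym (*-identityʳ x))) (e x≢0)

  -- 4 is the square of 2, and a field has no zero divisors.
  ⟦4⟧≡0⇒1+1≡0 : ⟦ 4 ⟧ ≡ 0# → 1# + 1# ≡ 0#
  ⟦4⟧≡0⇒1+1≡0 4≡0 with (1# + 1#) ≟ 0#
  ... | yes e   = e
  ... | no  2≢0 = contradiction (trans 2*2≡4 4≡0) (*-≢0 2≢0 2≢0)
    where
    2*2≡4 : (1# + 1#) * (1# + 1#) ≡ ⟦ 4 ⟧
    2*2≡4 = solve 0 ((con 1 :+ con 1) :* (con 1 :+ con 1)
      := con 1 :+ (con 1 :+ (con 1 :+ (con 1 :+ con 0)))) refl

  [x+y]²-char2 : 1# + 1# ≡ 0# → ∀ x y → (x + y) * (x + y) ≡ x * x + y * y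
  [x+y]²-char2 2≡0 x y = begin
    (x + y) * (x + y)                        ≡⟨ solve 2 (λ x y → (x :+ y) :* (x :+ y)
                                                  := x :* x :+ y :* y :+ (con 1 :+ con 1) :* (x :* y))
                                                  refl x y ⟩
    x * x + y * y + (1# + 1#) * (x * y)      ≡⟨ cong (λ z → x * x + y * y + z * (x * y)) 2≡0 ⟩
    x * x + y * y + 0# * (x * y)             ≡⟨ cong (x * x + y * y +_) (zeroˡ _) ⟩
    x * x + y * y + 0#                       ≡⟨ +-identityʳ _ ⟩
    x * x + y * y                            ∎

†-distrib-+ : ∀ {q} → q ∈ (2 ∷ 3 ∷ 4 ∷ []) → (F : FiniteField q) →
  let open FiniteField F
      open OverField F in
  ∀ x y → (x + y) † ≡ x † + y †
†-distrib-+ q∈ F = go q∈ ⟦q⟧≡0 x^q≡x-≢0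
  where
  open FiniteField F
  open OverField F
  open FieldProperties F
  open SemiringExp (CommutativeRing.semiring commutativeRing) using (_^_)

  additive-if-id : (∀ x → x † ≡ x) → ∀ x y → (x + y) † ≡ x † + y †
  additive-if-id †≡id x y = trans (†≡id _) (sym (cong₂ _+_ (†≡id x) (†≡id y)))

  -- The number `k` is kept apart from the index of `F`, so that the membership proof can be split
  -- while `F` stays fixed; all that is needed of `q` is passed as two equations.
  go : ∀ {k} → k ∈ (2 ∷ 3 ∷ 4 ∷ []) → ⟦ k ⟧ ≡ 0# → (∀ {x} → x ≢ 0# → x ^ k ≡ x) →
       ∀ x y → (x + y) † ≡ x † + y †
  go (here refl)                 _   fermat = additive-if-id λ _ → x²≡x⇒x†≡x fermat
  go (there (here refl))         _   fermat = additive-if-id λ _ → x³≡x⇒x†≡x fermat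
  go (there (there (here refl))) 4≡0 fermat x y = trans
    (†≡sq _)
    (trans ([x+y]²-char2 (⟦4⟧≡0⇒1+1≡0 4≡0) x y) (sym (cong₂ _+_ (†≡sq x) (†≡sq y))))
    where
    †≡sq : ∀ x → x † ≡ x * x
    †≡sq _ = x⁴≡x⇒x†≡x*x fermat

module GramMatrices {q : ℕ} (F : FiniteField q) where
  open FiniteField F
  open OverField F
  open CommutativeRing commutativeRing
    using (semiring; commutativeSemiring; +-commutativeMonoid; +-identityˡ; +-identityʳ;
           *-assoc; *-identityˡ; zeroˡ; zeroʳ; distribˡ)
  open SemiringSolver commutativeSemiring using (solve; _:+_; _:*_; _:=_)
  open FieldProperties F
  open ≡-Reasoning

  private
    module Σ where
      open SemiringSum semiring public
      open IndicatorSums +-commutativeMonoid public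
      open MonoidMult (CommutativeMonoid.monoid +-commutativeMonoid) public renaming (_×_ to _·_)

  -- Double counting in the blocks of `W`.

  module _ {n : ℕ} {g : Level} {W : Matrix n n} (G : PAutGroup W g) where
    open PAutGroup G

    -- Arbitrary functions on positions are allowed, since the indicator of a value of `W` and its
    -- restrictions to a row or column class must all qualify.
    Invariant : (Fin n → Fin n → ℕ) → Set g
    Invariant f = ∀ {σ τ} → Member (σ , τ) → ∀ x c → f (σ ⟨$⟩ʳ x) (τ ⟨$⟩ʳ c) ≡ f x c

    -- If `(σ , τ)` carries `x` to `y`, then permuting the columns by `τ` turns row `y` into row
    -- `x`.
    rowSum-invariant : ∀ {f} → Invariant f → ∀ {x y} → SameRowOrbit x y → ℕΣ.sum (f x) ≡ ℕΣ.sum (f y)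
    rowSum-invariant {f} inv {x} ((σ , τ) , h , refl) = sym (trans
      (ℕΣ.sum-permute (f (σ ⟨$⟩ʳ x)) τ)
      (ℕΣ.sum-cong-≗ (inv h x)))

    colSum-invariant : ∀ {f} → Invariant f → ∀ {c d} → SameColOrbit c d →
                       ℕΣ.sum (λ x → f x c) ≡ ℕΣ.sum (λ x → f x d)
    colSum-invariant {f} inv {c} ((σ , τ) , h , refl) = sym (trans
      (ℕΣ.sum-permute (λ x → f x (τ ⟨$⟩ʳ c)) σ)
      (ℕΣ.sum-cong-≗ λ x → inv h x c))

  module _ {n t ℓ : ℕ} {g : Level} {_~_ : Fin n → Fin n → Set g} (O : Orbits _~_ t ℓ) where
    open Orbits O

    index-≡ : ∀ {x y} → x ~ y → index x ≡ index y
    index-≡ = Equivalence.from (index-orb _ _)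

    orbit-sum : ∀ a (f : Fin n → ℕ) v → (∀ x → index x ≡ a → f x ≡ v) →
                ℕΣ.sum (λ x → if does (index x Fin.≟ a) then f x else 0) ≡ ℓ ℕ.* v
    orbit-sum a f v f≡v = begin
      ℕΣ.sum (λ x → if does (index x Fin.≟ a) then f x else 0)   ≡⟨ ℕΣ.sum-cong-≗ constant ⟩
      ℕΣ.sum (λ x → if does (index x Fin.≟ a) then v else 0)     ≡⟨ ℕΣ.#-· (λ x → index x Fin.≟ a) v ⟨
      # (λ x → index x Fin.≟ a) ℕΣ.· v                           ≡⟨ cong (ℕΣ._· v) (orb-length a) ⟩
      ℓ ℕΣ.· v                                                   ≡⟨ ℕΣ.·≡* ℓ v ⟩
      ℓ ℕ.* v                                                    ∎
      where
      constant : ∀ x → (if does (index x Fin.≟ a) then f x else 0) ≡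
                       (if does (index x Fin.≟ a) then v else 0)
      constant x with index x Fin.≟ a
      ... | yes e = f≡v x e
      ... | no  _ = refl

    -- The class of `x` contains `x`. Such a point must be given: for `n = 0` there are no classes,
    -- and nothing bounds `ℓ` from below.
    ℓ≥1 : Fin n → 1 ≤ ℓ
    ℓ≥1 x = subst (1 ≤_) (orb-length (index x)) (ℕΣ.#-≥1 (λ y → index y Fin.≟ index x) {x} refl)

  module _ {n t ℓ : ℕ} {g : Level} {W : Matrix n n} (G : PAutGroup W g)
           (rowOrbits : Orbits (PAutGroup.SameRowOrbit G) t ℓ)
           (colOrbits : Orbits (PAutGroup.SameColOrbit G) t ℓ) where
    open PAutGroup G
    private
      module 𝓡 = Orbits rowOrbits
      module 𝓒 = Orbits colOrbits

    -- Double counting over a block: ℓ times the row sum is the total, and so is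
    -- ℓ times the column sum.  Cancelling ℓ needs values in ℕ, as ℓ may vanish in F.
    blockRowSum≡blockColSum-ℕ : ∀ {f} → Invariant G f → ∀ x c →
      ℕΣ.sum (λ d → if does (𝓒.index d Fin.≟ 𝓒.index c) then f x d else 0) ≡
      ℕΣ.sum (λ y → if does (𝓡.index y Fin.≟ 𝓡.index x) then f y c else 0)
    blockRowSum≡blockColSum-ℕ {f} inv x c =
      ℕ.*-cancelˡ-≡ _ _ ℓ {{ℕ.>-nonZero (ℓ≥1 rowOrbits x)}} (begin
        ℓ ℕ.* ∑ (inCol x)
          ≡⟨ orbit-sum rowOrbits (𝓡.index x) (λ y → ∑ (inCol y)) _
               (λ y e → rowSum-invariant G inCol-invariant (Equivalence.to (𝓡.index-orb _ _) e)) ⟨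
        ∑ (λ y → if does (𝓡.index y Fin.≟ 𝓡.index x) then ∑ (inCol y) else 0)
          ≡⟨ ℕΣ.sum-cong-≗ (λ y → ℕΣ.if-sum (does (𝓡.index y Fin.≟ 𝓡.index x)) (inCol y)) ⟩
        ∑ (λ y → ∑ (λ d → if does (𝓡.index y Fin.≟ 𝓡.index x) then inCol y d else 0))
          ≡⟨ ℕΣ.∑-comm (λ y d → if does (𝓡.index y Fin.≟ 𝓡.index x) then inCol y d else 0) ⟩
        ∑ (λ d → ∑ (λ y → if does (𝓡.index y Fin.≟ 𝓡.index x) then inCol y d else 0))
          -- The same block total, now read by columns: the cut-off to the column class of `c` moves
          -- outside and the cut-off to the row class of `x` moves inside.
          ≡⟨ ℕΣ.sum-cong-≗ (λ d → ℕΣ.sum-cong-≗ λ y →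
               if-swap (does (𝓡.index y Fin.≟ 𝓡.index x)) (does (𝓒.index d Fin.≟ 𝓒.index c))) ⟩
        ∑ (λ d → ∑ (λ y → if does (𝓒.index d Fin.≟ 𝓒.index c) then inRow y d else 0))
          ≡⟨ ℕΣ.sum-cong-≗ (λ d → ℕΣ.if-sum (does (𝓒.index d Fin.≟ 𝓒.index c)) (λ y → inRow y d)) ⟨
        ∑ (λ d → if does (𝓒.index d Fin.≟ 𝓒.index c) then ∑ (λ y → inRow y d) else 0)
          ≡⟨ orbit-sum colOrbits (𝓒.index c) (λ d → ∑ (λ y → inRow y d)) _
               (λ d e → colSum-invariant G inRow-invariant (Equivalence.to (𝓒.index-orb _ _) e)) ⟩
        ℓ ℕ.* ∑ (λ y → inRow y c) ∎)
      where
      ∑ : ∀ {k} → (Fin k → ℕ) → ℕ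
      ∑ = ℕΣ.sum

      inCol inRow : Fin n → Fin n → ℕ
      inCol y d = if does (𝓒.index d Fin.≟ 𝓒.index c) then f y d else 0
      inRow y d = if does (𝓡.index y Fin.≟ 𝓡.index x) then f y d else 0

      inCol-invariant : Invariant G inCol
      inCol-invariant {σ} {τ} h y d = cong₂ (λ j v → if does (j Fin.≟ 𝓒.index c) then v else 0)
        (sym (index-≡ colOrbits ((σ , τ) , h , refl))) (inv h y d)

      inRow-invariant : Invariant G inRow
      inRow-invariant {σ} {τ} h y d = cong₂ (λ i v → if does (i Fin.≟ 𝓡.index x) then v else 0)
        (sym (index-≡ rowOrbits ((σ , τ) , h , refl))) (inv h y d)

    private
      sum-· : ∀ {k} (f : Fin k → ℕ) a → ℕΣ.sum f Σ.· a ≡ Σ.sum (λ i → f i Σ.· a)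
      sum-· {zero}  f a = refl
      sum-· {suc k} f a = trans (Σ.×-homo-+ a (f zero) (ℕΣ.sum (f ∘ suc)))
                                (cong (f zero Σ.· a +_) (sum-· (f ∘ suc) a))

      code : Carrier → Fin q
      code = Inverse.to enumeration

    -- Each selected entry is the sum over all field elements `v` of its indicator times `v`;
    -- exchanging the sums leaves only the number of occurrences of each `v`. This carries
    -- equalities of counts in `ℕ` over to sums in the field.
    sum-by-values : ∀ {k} (b : Fin k → Bool) (w : Fin k → Carrier) →
      Σ.sum (λ i → if b i then w i else 0#) ≡
      Σ.sum (λ v → ℕΣ.sum (λ i → if b i then (if does (code (w i) Fin.≟ v) then 1 else 0) else 0)
                     Σ.· Inverse.from enumeration v)
    sum-by-values b w = begin
      Σ.sum (λ i → if b i then w i else 0#)               ≡⟨ Σ.sum-cong-≗ (λ i → value (b i) (w i)) ⟩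
      Σ.sum (λ i → Σ.sum (λ v → hits i v Σ.· elem v))     ≡⟨ Σ.∑-comm (λ i v → hits i v Σ.· elem v) ⟩
      Σ.sum (λ v → Σ.sum (λ i → hits i v Σ.· elem v))     ≡⟨ Σ.sum-cong-≗ (λ v → sum-· (λ i → hits i v) (elem v)) ⟨
      Σ.sum (λ v → ℕΣ.sum (λ i → hits i v) Σ.· elem v)    ∎
      where
      elem : Fin q → Carrier
      elem = Inverse.from enumeration

      hits : Fin _ → Fin q → ℕ
      hits i v = if b i then (if does (code (w i) Fin.≟ v) then 1 else 0) else 0

      one-or-none : ∀ c a → (if c then 1 else 0) Σ.· a ≡ (if c then a else 0#)
      one-or-none true  a = +-identityʳ a
      one-or-none false a = refl

      value : ∀ c a → (if c then a else 0#) ≡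
        Σ.sum (λ v → (if c then (if does (code a Fin.≟ v) then 1 else 0) else 0) Σ.· elem v)
      value false a = sym (Σ.sum-replicate-zero q)
      value true  a = sym (begin
        Σ.sum (λ v → (if does (code a Fin.≟ v) then 1 else 0) Σ.· elem v)
          ≡⟨ Σ.sum-cong-≗ (λ v → one-or-none (does (code a Fin.≟ v)) (elem v)) ⟩
        Σ.sum (λ v → if does (code a Fin.≟ v) then elem v else 0#)
          ≡⟨ Σ.sum-δ (code a) elem ⟩
        elem (code a)
          ≡⟨ Inverse.strictlyInverseʳ enumeration a ⟩
        a ∎)

    -- For each `v` the indicator of the entries equal to `v` is invariant under `G`, so `v` occurs
    -- equally often in a row and in a column of the block. Both sums are then determined by the
    -- same counts.
    blockRowSum≡blockColSum : ∀ x c →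
      blockRowSum G rowOrbits colOrbits x (𝓒.index c) ≡
      Σ.sum (λ y → if does (𝓡.index y Fin.≟ 𝓡.index x) then W y c else 0#)
    blockRowSum≡blockColSum x c = begin
      blockRowSum G rowOrbits colOrbits x (𝓒.index c)
        ≡⟨ sum-by-values (λ d → does (𝓒.index d Fin.≟ 𝓒.index c)) (W x) ⟩
      _ ≡⟨ Σ.sum-cong-≗ (λ v → cong (Σ._· Inverse.from enumeration v)
             (blockRowSum≡blockColSum-ℕ (takes-invariant v) x c)) ⟩
      _ ≡⟨ sum-by-values (λ y → does (𝓡.index y Fin.≟ 𝓡.index x)) (λ y → W y c) ⟨
      Σ.sum (λ y → if does (𝓡.index y Fin.≟ 𝓡.index x) then W y c else 0#) ∎
      where
      takes-invariant : ∀ v → Invariant G (λ y d → if does (code (W y d) Fin.≟ v) then 1 else 0)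
      takes-invariant v {σ} {τ} h y d = cong (λ w → if does (code w Fin.≟ v) then 1 else 0)
        (PAut-entry {σ = σ} {τ} (⊆PAut h) y d)

  -- The Gram matrix of the row orbit matrix.

  module _ (†-distrib-+ : ∀ x y → (x + y) † ≡ x † + y †) where

    sum-† : ∀ {n} (f : Fin n → Carrier) → (Σ.sum f) † ≡ Σ.sum (λ i → f i †)
    sum-† {zero}  f = 0†≡0
    sum-† {suc n} f = trans (†-distrib-+ _ _) (cong (f zero † +_) (sum-† (f ∘ suc)))

    module _ {n m t ℓ : ℕ} {g : Level} {W : Matrix n n} (weighing : IsWeighing m W)
             (G : PAutGroup W g)
             (rowOrbits : Orbits (PAutGroup.SameRowOrbit G) t ℓ)
             (colOrbits : Orbits (PAutGroup.SameColOrbit G) t ℓ) where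
      private
        module 𝓡 = Orbits rowOrbits
        module 𝓒 = Orbits colOrbits

        R : Matrix t t
        R = rowOrbitMatrix G rowOrbits colOrbits

      -- As a column sum, the entry becomes a sum over the rows `y` of class `k` in the single
      -- column `c`; by additivity its conjugate is made of entries of `W ⋆`.
      R† : ∀ k c → R k (𝓒.index c) † ≡
                   Σ.sum (λ y → if does (𝓡.index y Fin.≟ k) then W y c † else 0#)
      R† k c = begin
        R k (𝓒.index c) †
          ≡⟨ cong _† (blockRowSum≡blockColSum G rowOrbits colOrbits (𝓡.representative k) c) ⟩
        Σ.sum (λ y → if does (𝓡.index y Fin.≟ 𝓡.index (𝓡.representative k)) then W y c else 0#) †
          ≡⟨ cong (λ k′ → Σ.sum (λ y → if does (𝓡.index y Fin.≟ k′) then W y c else 0#) †)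
               (proj₂ (𝓡.nonempty k)) ⟩
        Σ.sum (λ y → if does (𝓡.index y Fin.≟ k) then W y c else 0#) †
          ≡⟨ sum-† (λ y → if does (𝓡.index y Fin.≟ k) then W y c else 0#) ⟩
        Σ.sum (λ y → (if does (𝓡.index y Fin.≟ k) then W y c else 0#) †)
          ≡⟨ Σ.sum-cong-≗ (λ y → trans (if-float _† (does (𝓡.index y Fin.≟ k)))
               (if-cong-else (does (𝓡.index y Fin.≟ k)) 0†≡0)) ⟩
        Σ.sum (λ y → if does (𝓡.index y Fin.≟ k) then W y c † else 0#) ∎

      -- The first factor is expanded as a row sum and the second as a column sum. What remains is
      -- the sum of the products of row `x` with the rows `y` of class `k`; only `y = x` can
      -- contribute, and it does so exactly when `x` lies in class `k`.
      RR⋆≋mI : R ⊗ R ⋆ ≋ scalar ⟦ m ⟧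
      RR⋆≋mI i k = begin
        Σ.sum (λ j → R i j * R k j †)
          ≡⟨ Σ.sum-cong-≗ (λ j → trans (Σ.*-distribʳ-sum (R k j †) (inBlock j))
               (Σ.sum-cong-≗ λ c → if-*ʳ (does (𝓒.index c Fin.≟ j)) (W x c) (R k j †))) ⟩
        Σ.sum (λ j → Σ.sum (λ c → if does (𝓒.index c Fin.≟ j) then W x c * R k j † else 0#))
          ≡⟨ Σ.∑-comm (λ j c → if does (𝓒.index c Fin.≟ j) then W x c * R k j † else 0#) ⟩
        Σ.sum (λ c → Σ.sum (λ j → if does (𝓒.index c Fin.≟ j) then W x c * R k j † else 0#))
          -- Each column `c` lies in one class only, so the sum over `j` reduces to `j = index c`.
          ≡⟨ Σ.sum-cong-≗ (λ c → Σ.sum-δ (𝓒.index c) (λ j → W x c * R k j †)) ⟩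
        Σ.sum (λ c → W x c * R k (𝓒.index c) †)
          ≡⟨ Σ.sum-cong-≗ (λ c → trans (cong (W x c *_) (R† k c))
               (trans (Σ.*-distribˡ-sum (W x c) (inClass c))
                 (Σ.sum-cong-≗ λ y → if-*ˡ (does (𝓡.index y Fin.≟ k)) (W x c) (W y c †)))) ⟩
        Σ.sum (λ c → Σ.sum (λ y → if does (𝓡.index y Fin.≟ k) then W x c * W y c † else 0#))
          ≡⟨ Σ.∑-comm (λ c y → if does (𝓡.index y Fin.≟ k) then W x c * W y c † else 0#) ⟩
        Σ.sum (λ y → Σ.sum (λ c → if does (𝓡.index y Fin.≟ k) then W x c * W y c † else 0#))
          ≡⟨ Σ.sum-cong-≗ (λ y → Σ.if-sum (does (𝓡.index y Fin.≟ k)) (λ c → W x c * W y c †)) ⟨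
        Σ.sum (λ y → if does (𝓡.index y Fin.≟ k) then (W ⊗ W ⋆) x y else 0#)
          ≡⟨ Σ.sum-cong-≗ (λ y → trans
               (if-cong-then (does (𝓡.index y Fin.≟ k)) (IsWeighing.WW⋆≋mI weighing x y))
               (if-swap (does (𝓡.index y Fin.≟ k)) (does (x Fin.≟ y)))) ⟩
        Σ.sum (λ y → if does (x Fin.≟ y) then (if does (𝓡.index y Fin.≟ k) then ⟦ m ⟧ else 0#) else 0#)
          ≡⟨ Σ.sum-δ x (λ y → if does (𝓡.index y Fin.≟ k) then ⟦ m ⟧ else 0#) ⟩
        (if does (𝓡.index x Fin.≟ k) then ⟦ m ⟧ else 0#)
          ≡⟨ cong (λ i′ → if does (i′ Fin.≟ k) then ⟦ m ⟧ else 0#) (proj₂ (𝓡.nonempty i)) ⟩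
        scalar ⟦ m ⟧ i k ∎
        where
        x : Fin n
        x = 𝓡.representative i

        inBlock : Fin t → Fin n → Carrier
        inBlock j c = if does (𝓒.index c Fin.≟ j) then W x c else 0#

        inClass : Fin n → Fin n → Carrier
        inClass c y = if does (𝓡.index y Fin.≟ k) then W y c † else 0#

        if-*ʳ : ∀ b a c → (if b then a else 0#) * c ≡ (if b then a * c else 0#)
        if-*ʳ true  a c = refl
        if-*ʳ false a c = zeroˡ c

        if-*ˡ : ∀ b a c → a * (if b then c else 0#) ≡ (if b then a * c else 0#)
        if-*ˡ true  a c = refl
        if-*ˡ false a c = zeroʳ a

  -- Gram matrices of incidence matrices and of juxtapositions.

  BB⋆≡ : ∀ {t b r lam} {block : Fin b → Subset t} → IsRLambdaDesign block r lam →
         ∀ i k → (incidence block ⊗ incidence block ⋆) i k ≡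
                 (if does (i Fin.≟ k) then ⟦ r ⟧ else ⟦ lam ⟧)
  BB⋆≡ {r = r} {lam} {block} design i k with i Fin.≟ k
  ... | yes refl = begin
    Σ.sum (λ l → B i l * B i l †)     ≡⟨ Σ.sum-cong-≗ (λ l → idem (does (i ∈? block l))) ⟩
    Σ.sum (B i)                       ≡⟨ Σ.#-· (λ l → i ∈? block l) 1# ⟨
    ⟦ # (λ l → i ∈? block l) ⟧        ≡⟨ cong ⟦_⟧ (IsRLambdaDesign.point-degree design i) ⟩
    ⟦ r ⟧                             ∎
    where
    B = incidence block

    -- Since `_†` fixes 0 and 1, the product of two incidence entries is the indicator that the
    -- block contains both points; here the two points coincide.
    idem : ∀ a → (if a then 1# else 0#) * (if a then 1# else 0#) † ≡ (if a then 1# else 0#)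
    idem true  = †-inverseʳ (0≢1 ∘ sym)
    idem false = zeroˡ _
  ... | no i≢k = begin
    Σ.sum (λ l → B i l * B k l †)
      ≡⟨ Σ.sum-cong-≗ (λ l → ∧-* (does (i ∈? block l)) (does (k ∈? block l))) ⟩
    Σ.sum (λ l → if does ((i ∈? block l) ×-dec (k ∈? block l)) then 1# else 0#)
      ≡⟨ Σ.#-· (λ l → (i ∈? block l) ×-dec (k ∈? block l)) 1# ⟨
    ⟦ # (λ l → (i ∈? block l) ×-dec (k ∈? block l)) ⟧
      ≡⟨ cong ⟦_⟧ (IsRLambdaDesign.pair-degree design i k i≢k) ⟩
    ⟦ lam ⟧ ∎
    where
    B = incidence block

    ∧-* : ∀ a c → (if a then 1# else 0#) * (if c then 1# else 0#) † ≡ (if a ∧ c then 1# else 0#)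
    ∧-* true  true  = †-inverseʳ (0≢1 ∘ sym)
    ∧-* true  false = trans (cong (1# *_) 0†≡0) (zeroʳ 1#)
    ∧-* false c     = zeroˡ _

  ∣-⊗-⋆ : ∀ {k l o} (M : Matrix k l) (N : Matrix k o) → ∀ i j →
          ((M ∣ N) ⊗ (M ∣ N) ⋆) i j ≡ (M ⊗ M ⋆) i j + (N ⊗ N ⋆) i j
  ∣-⊗-⋆ {l = l} M N i j = trans
    (Σ.sum-↑ l (λ x → (M ∣ N) i x * ((M ∣ N) j x) †))
    (cong₂ _+_
      (Σ.sum-cong-≗ λ x → cong₂ (λ a b → a * b †) (lookup-++ˡ (M i) (N i) x) (lookup-++ˡ (M j) (N j) x))
      (Σ.sum-cong-≗ λ x → cong₂ (λ a b → a * b †) (lookup-++ʳ (M i) (N i) x) (lookup-++ʳ (M j) (N j) x)))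

  -- A criterion for Hermitian LCD codes.

  row∈generatedBy : ∀ {k N} (A : Matrix k N) i → generatedBy A (A i)
  row∈generatedBy A i = (λ x → if does (i Fin.≟ x) then 1# else 0#) , λ j → sym (trans
    (Σ.sum-cong-≗ λ x → if-1* (does (i Fin.≟ x)) (A x j))
    (Σ.sum-δ i (λ x → A x j)))
    where
    if-1* : ∀ b a → (if b then 1# else 0#) * a ≡ (if b then a else 0#)
    if-1* true  a = *-identityˡ a
    if-1* false a = zeroˡ a

  -- Linearity of the form in its first argument turns orthogonality to the rows into a linear
  -- system for the coefficients, with matrix `A ⊗ A ⋆`.
  ⟨combination,row⟩ : ∀ {k N} (A : Matrix k N) {v} (c : Fin k → Carrier) →
    (∀ j → v j ≡ Σ.sum (λ i → c i * A i j)) → ∀ x →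
    ⟨ v , A x ⟩ ≡ Σ.sum (λ i → c i * (A ⊗ A ⋆) i x)
  ⟨combination,row⟩ A {v} c v≡cA x = begin
    Σ.sum (λ j → v j * A x j †)
      ≡⟨ Σ.sum-cong-≗ (λ j → trans (cong (_* A x j †) (v≡cA j))
           (Σ.*-distribʳ-sum (A x j †) (λ i → c i * A i j))) ⟩
    Σ.sum (λ j → Σ.sum (λ i → c i * A i j * A x j †))
      ≡⟨ Σ.∑-comm (λ j i → c i * A i j * A x j †) ⟩
    Σ.sum (λ i → Σ.sum (λ j → c i * A i j * A x j †))
      ≡⟨ Σ.sum-cong-≗ (λ i → trans
           (Σ.sum-cong-≗ λ j → *-assoc (c i) (A i j) (A x j †))
           (sym (Σ.*-distribˡ-sum (c i) (λ j → A i j * A x j †)))) ⟩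
    Σ.sum (λ i → c i * (A ⊗ A ⋆) i x) ∎

  -- The eigenvalues of d I + a J are d and t a + d.
  gram-dI+aJ⇒LCD : ∀ {t N} (A : Matrix t N) (d a : Carrier) →
    (∀ i k → (A ⊗ A ⋆) i k ≡ (if does (k Fin.≟ i) then d else 0#) + a) →
    ⟦ t ⟧ * a + d ≢ 0# → d ≢ 0# → IsHermitianLCD (generatedBy A)
  gram-dI+aJ⇒LCD {t} A d a gram ta+d≢0 d≢0 = trivial , zero∈
    where
    zero∈ : ∀ {v} → ZeroCode v → generatedBy A v × (generatedBy A ᴴ) v
    zero∈ v≡0 =
      ((λ _ → 0#) , λ j → trans (v≡0 j) (sym (Σ.sum-zero λ i → zeroˡ (A i j)))) ,
      λ u _ → Σ.sum-zero λ j → trans (cong (_* u j †) (v≡0 j)) (zeroˡ _)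

    trivial : ∀ {v} → generatedBy A v × (generatedBy A ᴴ) v → ZeroCode v
    trivial {v} ((c , v≡cA) , v⊥A) j = trans (v≡cA j)
      (Σ.sum-zero λ i → trans (cong (_* A i j) (c≡0 i)) (zeroˡ _))
      where
      -- This is coordinate `k` of `c (d I + a J) = 0`: the diagonal part picks out `c k`, and the
      -- `J` part contributes the sum of all coefficients.
      equation : ∀ k → c k * d + Σ.sum c * a ≡ 0#
      equation k = begin
        c k * d + Σ.sum c * a
          ≡⟨ cong₂ _+_ (sym (Σ.sum-δ k (λ i → c i * d))) (Σ.*-distribʳ-sum a c) ⟩
        Σ.sum (λ i → if does (k Fin.≟ i) then c i * d else 0#) + Σ.sum (λ i → c i * a)
          ≡⟨ Σ.∑-distrib-+ (λ i → if does (k Fin.≟ i) then c i * d else 0#) (λ i → c i * a) ⟨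
        Σ.sum (λ i → (if does (k Fin.≟ i) then c i * d else 0#) + c i * a)
          ≡⟨ Σ.sum-cong-≗ (λ i → factor (does (k Fin.≟ i)) (c i)) ⟩
        Σ.sum (λ i → c i * ((if does (k Fin.≟ i) then d else 0#) + a))
          ≡⟨ Σ.sum-cong-≗ (λ i → cong (c i *_) (gram i k)) ⟨
        Σ.sum (λ i → c i * (A ⊗ A ⋆) i k)
          ≡⟨ ⟨combination,row⟩ A c v≡cA k ⟨
        ⟨ v , A k ⟩
          ≡⟨ v⊥A (A k) (row∈generatedBy A k) ⟩
        0# ∎
        where
        factor : ∀ b x → (if b then x * d else 0#) + x * a ≡ x * ((if b then d else 0#) + a)
        factor true  x = sym (distribˡ x d a)
        factor false x = trans (+-identityˡ _) (cong (x *_) (sym (+-identityˡ a)))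

      Σc≡0 : Σ.sum c ≡ 0#
      Σc≡0 = *≡0⇒≡0 ta+d≢0 (begin
        Σ.sum c * (⟦ t ⟧ * a + d)
          ≡⟨ solve 4 (λ s t a d → s :* (t :* a :+ d) := s :* d :+ t :* (s :* a)) refl
               -- The term `t * (Σ c * a)` is separated so that it can be spread over the `t`
               -- equations, one copy for each `k`.
               (Σ.sum c) ⟦ t ⟧ a d ⟩
        Σ.sum c * d + ⟦ t ⟧ * (Σ.sum c * a)
          ≡⟨ cong₂ _+_ (Σ.*-distribʳ-sum d c) t*x≡Σx ⟩
        Σ.sum (λ k → c k * d) + Σ.sum {t} (λ _ → Σ.sum c * a)
          ≡⟨ Σ.∑-distrib-+ (λ k → c k * d) (λ _ → Σ.sum c * a) ⟨
        Σ.sum (λ k → c k * d + Σ.sum c * a)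
          ≡⟨ Σ.sum-zero equation ⟩
        0# ∎)
        where
        t*x≡Σx : ∀ {x} → ⟦ t ⟧ * x ≡ Σ.sum {t} (λ _ → x)
        t*x≡Σx {x} = begin
          ⟦ t ⟧ * x                  ≡⟨ SemiringMult.×-assoc-* semiring t 1# x ⟩
          t Σ.· (1# * x)             ≡⟨ cong (t Σ.·_) (*-identityˡ x) ⟩
          t Σ.· x                    ≡⟨ Σ.sum-replicate t ⟨
          Σ.sum {t} (λ _ → x)        ∎

      c≡0 : ∀ k → c k ≡ 0#
      c≡0 k = *≡0⇒≡0 d≢0 (begin
        c k * d                   ≡⟨ +-identityʳ _ ⟨
        c k * d + 0#              ≡⟨ cong (c k * d +_) (trans (cong (_* a) Σc≡0) (zeroˡ a)) ⟨
        c k * d + Σ.sum c * a     ≡⟨ equation k ⟩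
        0#                        ∎)

-- The code generated by `[R | B]`.

theorem5p1 :
    ∀ {q : ℕ} → q ∈ (2 ∷ 3 ∷ 4 ∷ []) → (F : FiniteField q) →
    let open FiniteField F
        open OverField F in
    ∀ {n m t ℓ b r lam : ℕ} {g : Level}
    (W : Matrix n n) → IsWeighing m W →
    (G : PAutGroup W g)
    (rowOrbits : Orbits (PAutGroup.SameRowOrbit G) t ℓ)
    (colOrbits : Orbits (PAutGroup.SameColOrbit G) t ℓ)
    (block : Fin b → Subset t) → IsRLambdaDesign block r lam →
    ⟦ r ⟧ + (⟦ t ⟧ - 1#) * ⟦ lam ⟧ + ⟦ m ⟧ ≢ 0# →
    ⟦ r ⟧ - ⟦ lam ⟧ + ⟦ m ⟧ ≢ 0# →
    IsHermitianLCD (generatedBy (rowOrbitMatrix G rowOrbits colOrbits ∣ incidence block))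
theorem5p1 q∈ F {m = m} {t} {r = r} {lam} W weighing G rowOrbits colOrbits block design t≢0 d≢0 =
  gram-dI+aJ⇒LCD (R ∣ B) d ⟦ lam ⟧ gram (t≢0 ∘ trans eigenvalue) d≢0
  where
  open FiniteField F
  open OverField F
  open GramMatrices F
  open CommutativeRing commutativeRing
    using (commutativeSemiring; ring; +-identityʳ; -‿inverseˡ)
  open RingProperties ring using (-1*x≈-x)
  open SemiringSolver commutativeSemiring using (solve; _:+_; _:*_; _:=_)
  open ≡-Reasoning

  R = rowOrbitMatrix G rowOrbits colOrbits
  B = incidence block
  d = ⟦ r ⟧ - ⟦ lam ⟧ + ⟦ m ⟧

  -- Identifies the first quantity assumed non-zero with the eigenvalue of `d I + lam J` on the
  -- all-ones vector.
  eigenvalue : ⟦ r ⟧ + (⟦ t ⟧ - 1#) * ⟦ lam ⟧ + ⟦ m ⟧ ≡ ⟦ t ⟧ * ⟦ lam ⟧ + d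
  eigenvalue = begin
    ⟦ r ⟧ + (⟦ t ⟧ - 1#) * ⟦ lam ⟧ + ⟦ m ⟧
      -- `- 1#` enters as an independent variable `n`, which leaves an identity of commutative
      -- semirings.
      ≡⟨ solve 5 (λ r t l m n → r :+ (t :+ n) :* l :+ m := t :* l :+ (r :+ n :* l :+ m)) refl
           ⟦ r ⟧ ⟦ t ⟧ ⟦ lam ⟧ ⟦ m ⟧ (- 1#) ⟩
    ⟦ t ⟧ * ⟦ lam ⟧ + (⟦ r ⟧ + (- 1#) * ⟦ lam ⟧ + ⟦ m ⟧)
      ≡⟨ cong (λ x → ⟦ t ⟧ * ⟦ lam ⟧ + (⟦ r ⟧ + x + ⟦ m ⟧)) (-1*x≈-x ⟦ lam ⟧) ⟩
    ⟦ t ⟧ * ⟦ lam ⟧ + d ∎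

  gram : ∀ i k → ((R ∣ B) ⊗ (R ∣ B) ⋆) i k ≡ (if does (k Fin.≟ i) then d else 0#) + ⟦ lam ⟧
  gram i k = begin
    ((R ∣ B) ⊗ (R ∣ B) ⋆) i k
      ≡⟨ ∣-⊗-⋆ R B i k ⟩
    (R ⊗ R ⋆) i k + (B ⊗ B ⋆) i k
      ≡⟨ cong₂ _+_ (RR⋆≋mI (†-distrib-+ q∈ F) weighing G rowOrbits colOrbits i k) (BB⋆≡ design i k) ⟩
    scalar ⟦ m ⟧ i k + (if does (i Fin.≟ k) then ⟦ r ⟧ else ⟦ lam ⟧)
      -- `scalar` compares `i` with `k`, whereas the criterion compares `k` with `i`.
      ≡⟨ cong (λ e → (if e then ⟦ m ⟧ else 0#) + (if e then ⟦ r ⟧ else ⟦ lam ⟧))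
           (does-⇔ (mk⇔ sym sym) (i Fin.≟ k) (k Fin.≟ i)) ⟩
    (if does (k Fin.≟ i) then ⟦ m ⟧ else 0#) + (if does (k Fin.≟ i) then ⟦ r ⟧ else ⟦ lam ⟧)
      ≡⟨ entry (does (k Fin.≟ i)) ⟩
    (if does (k Fin.≟ i) then d else 0#) + ⟦ lam ⟧ ∎
    where
    entry : ∀ e → (if e then ⟦ m ⟧ else 0#) + (if e then ⟦ r ⟧ else ⟦ lam ⟧) ≡
                  (if e then d else 0#) + ⟦ lam ⟧
    entry false = refl
    entry true  = begin
      ⟦ m ⟧ + ⟦ r ⟧                                     ≡⟨ +-identityʳ _ ⟨
      -- The inserted zero becomes `- lam + lam`: one part completes `d`, the other is the diagonal
      -- entry of `lam J`.
      ⟦ m ⟧ + ⟦ r ⟧ + 0#                                ≡⟨ cong (⟦ m ⟧ + ⟦ r ⟧ +_) (-‿inverseˡ ⟦ lam ⟧) ⟨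
      ⟦ m ⟧ + ⟦ r ⟧ + (- ⟦ lam ⟧ + ⟦ lam ⟧)             ≡⟨ solve 4 (λ m r n l →
                                                            m :+ r :+ (n :+ l) := r :+ n :+ m :+ l) refl
                                                            ⟦ m ⟧ ⟦ r ⟧ (- ⟦ lam ⟧) ⟦ lam ⟧ ⟩
      d + ⟦ lam ⟧                                       ∎
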